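{- Let $m,n$ be distinct square-free rational integers such that $K=\mathbb{Q}(\sqrt{m},\sqrt{n})$ is a quartic number field, let $\mathcal{A}=\mathbb{Z}[\sqrt{m},\sqrt{n}]$, and let $\sigma,\tau$ be any two non-zero ring endomorphisms of $\mathcal{A}$. A non-zero $\mathbb{Z}$-linear map $D:\mathcal{A}\to\mathcal{A}$ with $D(1)=0$ is a $(\sigma,\tau)$-derivation if and only if exactly one of the following cases holds: (i) $D(\sqrt{m})=0$, $D(\sqrt{n})\neq 0$, $D(\sqrt{mn})\neq 0$, and either $(\sigma,\tau)\in\{(\phi_{1},\phi_{2}),(\phi_{2},\phi_{1})\}$ and $D(\sqrt{mn})=\sqrt{m}\,D(\sqrt{n})$, or $(\sigma,\tau)\in\{(\phi_{3},\phi_{4}),(\phi_{4},\phi_{3})\}$ and $D(\sqrt{mn})=-\sqrt{m}\,D(\sqrt{n})$. (ii) $D(\sqrt{m})\neq 0$, $D(\sqrt{n})=0$, $D(\sqrt{mn})\neq 0$, and either $(\sigma,\tau)\in\{(\phi_{1},\phi_{3}),(\phi_{3},\phi_{1})\}$ and $D(\sqrt{mn})=\sqrt{n}\,D(\sqrt{m})$, or $(\sigma,\tau)\in\{(\phi_{2},\phi_{4}),(\phi_{4},\phi_{2})\}$ and $D(\sqrt{mn})=-\sqrt{n}\,D(\sqrt{m})$. (iii) $D(\sqrt{m})\neq 0$, $D(\sqrt{n})\neq 0$, $D(\sqrt{mn})=0$, and either $(\sigma,\tau)\in\{(\phi_{1},\phi_{4}),(\phi_{4},\phi_{1})\}$ and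 $\sqrt{m}\,D(\sqrt{n})=\sqrt{n}\,D(\sqrt{m})$, or $(\sigma,\tau)\in\{(\phi_{2},\phi_{3}),(\phi_{3},\phi_{2})\}$ and $\sqrt{m}\,D(\sqrt{n})=-\sqrt{n}\,D(\sqrt{m})$.
   Context: Here $\sqrt{mn}$ denotes $\sqrt{m}\cdot\sqrt{n}$, and $\{1,\sqrt{m},\sqrt{n},\sqrt{mn}\}$ is a $\mathbb{Z}$-basis of $\mathcal{A}$. A $(\sigma,\tau)$-derivation of $\mathcal{A}$ is a $\mathbb{Z}$-linear map $D:\mathcal{A}\to\mathcal{A}$ with $D(xy)=D(x)\tau(y)+\sigma(x)D(y)$ for all $x,y\in\mathcal{A}$. The non-zero ring endomorphisms of $\mathcal{A}$ are $\phi_{1},\phi_{2},\phi_{3},\phi_{4}$, determined by: $\phi_{1}(\sqrt{m})=\sqrt{m}$, $\phi_{1}(\sqrt{n})=\sqrt{n}$; $\phi_{2}(\sqrt{m})=\sqrt{m}$, $\phi_{2}(\sqrt{n})=-\sqrt{n}$; $\phi_{3}(\sqrt{m})=-\sqrt{m}$, $\phi_{3}(\sqrt{n})=\sqrt{n}$; $\phi_{4}(\sqrt{m})=-\sqrt{m}$, $\phi_{4}(\sqrt{n})=-\sqrt{n}$. -}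

module Defs where

open import Algebra.Apartness.Bundles using (HeytingField; HeytingCommutativeRing)
open import Algebra.Bundles using (CommutativeRing; RawRing)
open import Algebra.Module.Bundles.Raw using (RawLeftModule)
open import Algebra.Module.Morphism.Structures using (module LeftModuleMorphisms)
import Algebra.Morphism.RingMonomorphism as RingMonomorphism
open import Algebra.Morphism.Structures
  using (module RingMorphisms; module RingWithoutOneMorphisms)
import Algebra.Definitions.RawMonoid as RawMonoidOps
open import Data.Fin using (Fin)
open import Data.Integer as ℤ using (ℤ; +_; -[1+_]; ∣_∣)
open import Data.Integer.Divisibility using (_∣_)
open import Data.Nat using (ℕ; suc)
open import Data.Product using (Σ-syntax; ∃; ∃-syntax; _×_; _,_; proj₁)
open import Data.Rational as ℚ using (ℚ; 0ℚ; _/_)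
open import Data.Sum using (_⊎_)
open import Level as L using (Level; _⊔_)
open import Relation.Binary.PropositionalEquality using (_≡_)
open import Relation.Nullary using (¬_)

private
  variable
    a b d : Level

SquareFree : ℤ → Set
SquareFree m = ∀ (k : ℤ) → (k ℤ.* k) ∣ m → ∣ k ∣ ≡ 1

ExactlyOne : Set a → Set b → Set d → Set (a ⊔ b ⊔ d)
ExactlyOne P Q R = (P × ¬ Q × ¬ R) ⊎ (¬ P × Q × ¬ R) ⊎ (¬ P × ¬ Q × R)

module _ {c ℓ₁ ℓ₂} (K : HeytingField c ℓ₁ ℓ₂) where
  open HeytingField K
    using (Carrier; _≈_; _+_; _*_; -_; 0#; 1#; heytingCommutativeRing)

  fieldAsCommutativeRing : CommutativeRing c ℓ₁
  fieldAsCommutativeRing =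
    HeytingCommutativeRing.commutativeRing heytingCommutativeRing

  fieldRawRing : RawRing c ℓ₁
  fieldRawRing = CommutativeRing.rawRing fieldAsCommutativeRing

  open RawMonoidOps (RawRing.+-rawMonoid fieldRawRing) using (sum)

  -- The smallest subring (with 1) containing x and y.
  data Subring⟨_,_⟩ (x y : Carrier) : Carrier → Set (c ⊔ ℓ₁) where
    gen₁ : Subring⟨ x , y ⟩ x
    gen₂ : Subring⟨ x , y ⟩ y
    zero : Subring⟨ x , y ⟩ 0#
    one  : Subring⟨ x , y ⟩ 1#
    add  : ∀ {u v} → Subring⟨ x , y ⟩ u → Subring⟨ x , y ⟩ v → Subring⟨ x , y ⟩ (u + v)
    mul  : ∀ {u v} → Subring⟨ x , y ⟩ u → Subring⟨ x , y ⟩ v → Subring⟨ x , y ⟩ (u * v)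
    neg  : ∀ {u} → Subring⟨ x , y ⟩ u → Subring⟨ x , y ⟩ (- u)
    resp : ∀ {u v} → u ≈ v → Subring⟨ x , y ⟩ u → Subring⟨ x , y ⟩ v

  -- The smallest subfield containing x and y.
  data Subfield⟨_,_⟩ (x y : Carrier) : Carrier → Set (c ⊔ ℓ₁) where
    gen₁ : Subfield⟨ x , y ⟩ x
    gen₂ : Subfield⟨ x , y ⟩ y
    zero : Subfield⟨ x , y ⟩ 0#
    one  : Subfield⟨ x , y ⟩ 1#
    add  : ∀ {u v} → Subfield⟨ x , y ⟩ u → Subfield⟨ x , y ⟩ v → Subfield⟨ x , y ⟩ (u + v)
    mul  : ∀ {u v} → Subfield⟨ x , y ⟩ u → Subfield⟨ x , y ⟩ v → Subfield⟨ x , y ⟩ (u * v)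
    neg  : ∀ {u} → Subfield⟨ x , y ⟩ u → Subfield⟨ x , y ⟩ (- u)
    inv  : ∀ {u v} → u * v ≈ 1# → Subfield⟨ x , y ⟩ u → Subfield⟨ x , y ⟩ v
    resp : ∀ {u v} → u ≈ v → Subfield⟨ x , y ⟩ u → Subfield⟨ x , y ⟩ v

  module _ (ι : ℚ → Carrier) where

    linearCombination : ∀ {k} → (Fin k → ℚ) → (Fin k → Carrier) → Carrier
    linearCombination q e = sum (λ i → ι (q i) * e i)

    record IsℚBasis {k} (e : Fin k → Carrier) : Set (c ⊔ ℓ₁) where
      field
        spanning    : ∀ x → ∃[ q ] x ≈ linearCombination q e
        independent : ∀ q → linearCombination q e ≈ 0# → ∀ i → q i ≡ 0ℚ

-- A field K = ℚ(√m, √n).  The structure map ι exhibits K as an extension of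
-- ℚ (so K has characteristic 0); √m and √n are arbitrary square roots in K.
record AdjoinSquareRoots (m n : ℤ) c ℓ₁ ℓ₂ : Set (L.suc (c ⊔ ℓ₁ ⊔ ℓ₂)) where
  field
    K : HeytingField c ℓ₁ ℓ₂

  open HeytingField K using (Carrier; _≈_; _*_)

  field
    ι         : ℚ → Carrier
    ι-homo    : RingMorphisms.IsRingHomomorphism ℚ.+-*-rawRing (fieldRawRing K) ι
    root-m    : Carrier
    root-n    : Carrier
    root-m²   : root-m * root-m ≈ ι (m / 1)
    root-n²   : root-n * root-n ≈ ι (n / 1)
    generated : ∀ x → Subfield⟨_,_⟩ K root-m root-n x

  HasDegree : ℕ → Set (c ⊔ ℓ₁)
  HasDegree k = Σ[ e ∈ (Fin k → Carrier) ] IsℚBasis K ι e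

module Order {m n c ℓ₁ ℓ₂} (F : AdjoinSquareRoots m n c ℓ₁ ℓ₂) where
  open AdjoinSquareRoots F
  private module K = HeytingField K

  -- ℤ[√m, √n] as a subring of K, with the equality of K.
  rawRing : RawRing (c ⊔ ℓ₁) ℓ₁
  rawRing = record
    { Carrier = ∃ (Subring⟨_,_⟩ K root-m root-n)
    ; _≈_     = λ x y → proj₁ x K.≈ proj₁ y
    ; _+_     = λ { (x , p) (y , q) → x K.+ y , add p q }
    ; _*_     = λ { (x , p) (y , q) → x K.* y , mul p q }
    ; -_      = λ { (x , p) → K.- x , neg p }
    ; 0#      = K.0# , zero
    ; 1#      = K.1# , one
    }

  private
    inclusion : RingMorphisms.IsRingMonomorphism rawRing (fieldRawRing K) proj₁
    inclusion = record
      { isRingHomomorphism = record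
        { isSemiringHomomorphism = record
          { isNearSemiringHomomorphism = record
            { +-isMonoidHomomorphism = record
              { isMagmaHomomorphism = record
                { isRelHomomorphism = record { cong = λ p → p }
                ; homo = λ _ _ → K.refl
                }
              ; ε-homo = K.refl
              }
            ; *-homo = λ _ _ → K.refl
            }
          ; 1#-homo = K.refl
          }
        ; -‿homo = λ _ → K.refl
        }
      ; injective = λ p → p
      }

  𝒜 : CommutativeRing (c ⊔ ℓ₁) ℓ₁
  𝒜 = record
    { RawRing rawRing
    ; isCommutativeRing =
        RingMonomorphism.isCommutativeRing inclusion K.isCommutativeRing
    }

  open CommutativeRing 𝒜 public
    using (Carrier; _≈_; _≉_; _+_; _*_; -_; 0#; 1#)

  √m √n √mn : Carrier
  √m  = root-m , gen₁
  √n  = root-n , gen₂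
  √mn = √m * √n

  open RawMonoidOps (RawRing.+-rawMonoid rawRing) using () renaming (_×_ to _×ℕ_)

  infixr 7 _·_
  _·_ : ℤ → Carrier → Carrier
  (+ k)    · x = k ×ℕ x
  -[1+ k ] · x = - (suc k ×ℕ x)

  ℤ-module : RawLeftModule ℤ (c ⊔ ℓ₁) ℓ₁
  ℤ-module = record
    { _≈ᴹ_ = _≈_ ; _+ᴹ_ = _+_ ; _*ₗ_ = _·_ ; 0ᴹ = 0# ; -ᴹ_ = -_ }

  IsℤLinear : (Carrier → Carrier) → Set (c ⊔ ℓ₁)
  IsℤLinear = LeftModuleMorphisms.IsLeftModuleHomomorphism ℤ-module ℤ-module

  NonZero : (Carrier → Carrier) → Set (c ⊔ ℓ₁)
  NonZero f = ¬ (∀ x → f x ≈ 0#)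

  -- Preservation of 1 is not assumed, which is why non-zeroness has to be.
  IsNonZeroEndomorphism : (Carrier → Carrier) → Set (c ⊔ ℓ₁)
  IsNonZeroEndomorphism σ = IsRingWithoutOneHomomorphism σ × NonZero σ
    where
    open RingWithoutOneMorphisms
      (RawRing.rawRingWithoutOne rawRing) (RawRing.rawRingWithoutOne rawRing)

  -- Isφᵢ σ says that the ring endomorphism σ is φᵢ: an endomorphism is
  -- determined by its values on √m and √n.
  Isφ₁ Isφ₂ Isφ₃ Isφ₄ : (Carrier → Carrier) → Set ℓ₁
  Isφ₁ σ = σ √m ≈ √m   × σ √n ≈ √n
  Isφ₂ σ = σ √m ≈ √m   × σ √n ≈ - √n
  Isφ₃ σ = σ √m ≈ - √m × σ √n ≈ √n
  Isφ₄ σ = σ √m ≈ - √m × σ √n ≈ - √n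

  module _ (σ τ : Carrier → Carrier) where

    record IsDerivation (D : Carrier → Carrier) : Set (c ⊔ ℓ₁) where
      field
        isℤLinear : IsℤLinear D
        leibniz   : ∀ x y → D (x * y) ≈ D x * τ y + σ x * D y

    -- (σ, τ) ∈ {(φ, ψ), (ψ, φ)}.
    InPairs : (φ ψ : (Carrier → Carrier) → Set ℓ₁) → Set ℓ₁
    InPairs φ ψ = (φ σ × ψ τ) ⊎ (ψ σ × φ τ)

    CaseI CaseII CaseIII : (Carrier → Carrier) → Set ℓ₁
    CaseI D =
      D √m ≈ 0# × D √n ≉ 0# × D √mn ≉ 0# ×
      ( (InPairs Isφ₁ Isφ₂ × D √mn ≈ √m * D √n)
      ⊎ (InPairs Isφ₃ Isφ₄ × D √mn ≈ - √m * D √n) )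
    CaseII D =
      D √m ≉ 0# × D √n ≈ 0# × D √mn ≉ 0# ×
      ( (InPairs Isφ₁ Isφ₃ × D √mn ≈ √n * D √m)
      ⊎ (InPairs Isφ₂ Isφ₄ × D √mn ≈ - √n * D √m) )
    CaseIII D =
      D √m ≉ 0# × D √n ≉ 0# × D √mn ≈ 0# ×
      ( (InPairs Isφ₁ Isφ₄ × √m * D √n ≈ √n * D √m)
      ⊎ (InPairs Isφ₂ Isφ₃ × √m * D √n ≈ - √n * D √m) )

{-# OPTIONS --safe #-}

-- Call a pair (x , y) Leibniz if D (x y) = D x · τ y + σ x · D y.  The Leibniz
-- defect of an additive map is biadditive and satisfies a 2-cocycle identity,
-- and it vanishes as soon as one argument is an integer.  As 𝒜 is spanned over
-- ℤ by 1, √m, √n, √m√n, a ℤ-linear D with D 1 = 0 is therefore a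
-- (σ,τ)-derivation iff the four pairs formed from √m and √n are Leibniz.  Since
-- σ √m and τ √m are both ±√m and σ √n and τ √n are both ±√n, these four
-- equations are solved according to whether σ and τ agree on √m and on √n;
-- if they agree on both, D = 0.
module Submission where

open import Defs
open import Algebra.Bundles using (CommutativeRing; RawRing)
open import Algebra.Apartness.Bundles using (HeytingField)
import Algebra.Apartness.Properties.HeytingCommutativeRing as HeytingProperties
open import Algebra.Morphism.Structures
  using (module GroupMorphisms; module RingMorphisms; module RingWithoutOneMorphisms)
open import Algebra.Module.Morphism.Structures using (module LeftModuleMorphisms)
import Algebra.Properties.Group as GroupProperties
import Algebra.Properties.Monoid.Sum as MonoidSum
import Algebra.Properties.Ring as RingProperties
import Algebra.Properties.Semiring.Mult as SemiringMult
import Algebra.Solver.Ring.NaturalCoefficients.Default as SemiringSolver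
open import Data.Empty using (⊥-elim)
import Data.Fin.Properties as Fin
open import Data.Integer as ℤ using (ℤ; +_; -[1+_])
import Data.Integer.Properties as ℤ
open import Data.Nat using (zero; suc)
import Data.Nat.Divisibility as ℕ
open import Data.Product using (_×_; _,_; proj₁; proj₂)
open import Data.Rational as ℚ using (0ℚ; 1ℚ; _/_)
open import Data.Rational.Literals using (fromℤ)
import Data.Rational.Properties as ℚ
open import Data.Sum using (_⊎_; inj₁; inj₂)
open import Function.Base using (_∘_)
open import Function.Bundles using (_⇔_; mk⇔; Equivalence)
open import Level using (_⊔_)
open import Relation.Binary.PropositionalEquality as ≡ using (_≡_; _≢_)
import Relation.Binary.Reasoning.Setoid as SetoidReasoning
open import Relation.Nullary using (Dec; yes; no; ¬_)

-- Integer multiples in a commutative ring and additive maps.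

module IntegerMultiples {c ℓ} (R : CommutativeRing c ℓ) where
  open CommutativeRing R
  open RingProperties ring using (-‿distribˡ-*)
  open SemiringMult semiring using (×-assoc-*; ×-congʳ) renaming (_×_ to _×ℕ_)
  open SetoidReasoning setoid

  infixr 8 _·_
  _·_ : ℤ → Carrier → Carrier
  (+ k)    · x = k ×ℕ x
  -[1+ k ] · x = - (suc k ×ℕ x)

  IsAdditive : (Carrier → Carrier) → Set (c ⊔ ℓ)
  IsAdditive =
    GroupMorphisms.IsGroupHomomorphism (RawRing.+-rawGroup rawRing) (RawRing.+-rawGroup rawRing)

  ×ℕ-as-* : ∀ k x → k ×ℕ x ≈ (k ×ℕ 1#) * x
  ×ℕ-as-* k x = sym (trans (×-assoc-* k 1# x) (×-congʳ k (*-identityˡ x)))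

  -- This turns the action of ℤ into multiplication by a ring element, so that relations such as
  -- `r * r ≈ m · 1#` can be used inside products.
  ·-as-* : ∀ k x → k · x ≈ (k · 1#) * x
  ·-as-* (+ k)    x = ×ℕ-as-* k x
  ·-as-* -[1+ k ] x = trans (-‿cong (×ℕ-as-* (suc k) x)) (-‿distribˡ-* _ _)

  ·-congʳ : ∀ k {x y} → x ≈ y → k · x ≈ k · y
  ·-congʳ (+ k)    x≈y = ×-congʳ k x≈y
  ·-congʳ -[1+ k ] x≈y = -‿cong (×-congʳ (suc k) x≈y)

  ·-zeroʳ : ∀ k → k · 0# ≈ 0#
  ·-zeroʳ k = trans (·-as-* k 0#) (zeroʳ _)

  module _ {f : Carrier → Carrier} (f-additive : IsAdditive f) where
    open GroupMorphisms.IsGroupHomomorphism f-additive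

    ×ℕ-homo : ∀ k x → f (k ×ℕ x) ≈ k ×ℕ f x
    ×ℕ-homo zero    x = ε-homo
    ×ℕ-homo (suc k) x = trans (homo x (k ×ℕ x)) (+-congˡ (×ℕ-homo k x))

    ·-homo : ∀ k x → f (k · x) ≈ k · f x
    ·-homo (+ k)    x = ×ℕ-homo k x
    ·-homo -[1+ k ] x = trans (⁻¹-homo _) (-‿cong (×ℕ-homo (suc k) x))

module Biquadratic {c ℓ} (R : CommutativeRing c ℓ) where
  open CommutativeRing R
  open IntegerMultiples R
  open RingProperties ring
    using (-‿distribˡ-*; -‿distribʳ-*; -‿involutive; -‿+-comm; -0#≈0#)
  open GroupProperties +-group using (x∙y⁻¹≈ε⇒x≈y; inverseˡ-unique)
  open SemiringMult semiring using () renaming (_×_ to _×ℕ_)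
  open SetoidReasoning setoid
  open SemiringSolver commutativeSemiring

  -- The additive span of 1, r, s and rs, for square roots r and s of integers.

  module Roots
    (m n : ℤ) (r s : Carrier) (r²≈m : r * r ≈ m · 1#) (s²≈n : s * s ≈ n · 1#) where

    -- The ℤ-span is given as a closure under sums and negatives instead of by coefficients, so that
    -- additive properties extend from the four generators by structural recursion.
    data Span : Carrier → Set (c ⊔ ℓ) where
      one  : Span 1#
      fst  : Span r
      snd  : Span s
      both : Span (r * s)
      add  : ∀ {x y} → Span x → Span y → Span (x + y)
      neg  : ∀ {x} → Span x → Span (- x)
      resp : ∀ {x y} → x ≈ y → Span x → Span y

    span-0 : Span 0#
    span-0 = resp (-‿inverseʳ 1#) (add one (neg one))

    span-×ℕ : ∀ k {x} → Span x → Span (k ×ℕ x)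
    span-×ℕ zero    p = span-0
    span-×ℕ (suc k) p = add p (span-×ℕ k p)

    span-· : ∀ k {x} → Span x → Span (k · x)
    span-· (+ k)    p = span-×ℕ k p
    span-· -[1+ k ] p = neg (span-×ℕ (suc k) p)

    r²y≈my : ∀ y → r * (r * y) ≈ m · y
    r²y≈my y = trans (sym (*-assoc r r y)) (trans (*-congʳ r²≈m) (sym (·-as-* m y)))

    s²y≈ny : ∀ y → s * (s * y) ≈ n · y
    s²y≈ny y = trans (sym (*-assoc s s y)) (trans (*-congʳ s²≈n) (sym (·-as-* n y)))

    -- Up to integer factors, r permutes the generators: it takes 1 to r, r to m, s to rs and rs to
    -- ms.
    span-r* : ∀ {y} → Span y → Span (r * y)
    span-r* one        = resp (sym (*-identityʳ r)) fst
    span-r* fst        = resp (sym r²≈m) (span-· m one)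
    span-r* snd        = both
    span-r* both       = resp (sym (r²y≈my s)) (span-· m snd)
    span-r* (add p q)  = resp (sym (distribˡ r _ _)) (add (span-r* p) (span-r* q))
    span-r* (neg p)    = resp (-‿distribʳ-* r _) (neg (span-r* p))
    span-r* (resp e p) = resp (*-congˡ e) (span-r* p)

    span-s* : ∀ {y} → Span y → Span (s * y)
    span-s* one        = resp (sym (*-identityʳ s)) snd
    span-s* fst        = resp (*-comm r s) both
    span-s* snd        = resp (sym s²≈n) (span-· n one)
    span-s* both       =
      resp (sym (trans (*-congˡ (*-comm r s)) (s²y≈ny r))) (span-· n fst)
    span-s* (add p q)  = resp (sym (distribˡ s _ _)) (add (span-s* p) (span-s* q))
    span-s* (neg p)    = resp (-‿distribʳ-* s _) (neg (span-s* p))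
    span-s* (resp e p) = resp (*-congˡ e) (span-s* p)

    span-* : ∀ {x y} → Span x → Span y → Span (x * y)
    span-* one        q = resp (sym (*-identityˡ _)) q
    span-* fst        q = span-r* q
    span-* snd        q = span-s* q
    span-* both       q = resp (sym (*-assoc r s _)) (span-r* (span-s* q))
    span-* (add p p′) q = resp (sym (distribʳ _ _ _)) (add (span-* p q) (span-* p′ q))
    span-* (neg p)    q = resp (-‿distribˡ-* _ _) (neg (span-* p q))
    span-* (resp e p) q = resp (*-congʳ e) (span-* p q)

    -- The Leibniz rule, from pairs of roots to all pairs.

    module Leibniz (span : ∀ x → Span x) {σ τ D : Carrier → Carrier}
      (σ-homo : RingMorphisms.IsRingHomomorphism rawRing rawRing σ)
      (τ-homo : RingMorphisms.IsRingHomomorphism rawRing rawRing τ)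
      (D-additive : IsAdditive D) (D1≈0 : D 1# ≈ 0#)
      where

      private
        module σ = RingMorphisms.IsRingHomomorphism σ-homo
        module τ = RingMorphisms.IsRingHomomorphism τ-homo
        module D = GroupMorphisms.IsGroupHomomorphism D-additive

      LeibnizAt : Carrier → Carrier → Set ℓ
      LeibnizAt x y = D (x * y) ≈ D x * τ y + σ x * D y

      D-·1≈0 : ∀ k → D (k · 1#) ≈ 0#
      D-·1≈0 k = trans (·-homo D-additive k 1#) (trans (·-congʳ k D1≈0) (·-zeroʳ k))

      D-r²≈0 : D (r * r) ≈ 0#
      D-r²≈0 = trans (D.⟦⟧-cong r²≈m) (D-·1≈0 m)

      D-s²≈0 : D (s * s) ≈ 0#
      D-s²≈0 = trans (D.⟦⟧-cong s²≈n) (D-·1≈0 n)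

      leibniz-cong : ∀ {x x′ y y′} → x ≈ x′ → y ≈ y′ → LeibnizAt x y → LeibnizAt x′ y′
      leibniz-cong {x} {x′} {y} {y′} x≈x′ y≈y′ l = begin
        D (x′ * y′)             ≈⟨ D.⟦⟧-cong (*-cong x≈x′ y≈y′) ⟨
        D (x * y)               ≈⟨ l ⟩
        D x * τ y + σ x * D y
          ≈⟨ +-cong (*-cong (D.⟦⟧-cong x≈x′) (τ.⟦⟧-cong y≈y′))
                    (*-cong (σ.⟦⟧-cong x≈x′) (D.⟦⟧-cong y≈y′)) ⟩
        D x′ * τ y′ + σ x′ * D y′ ∎

      -- Since D kills `k · 1#` and σ fixes it, both sides equal `k · D y`.
      leibniz-·1ˡ : ∀ k y → LeibnizAt (k · 1#) y
      leibniz-·1ˡ k y = begin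
        D ((k · 1#) * y)                       ≈⟨ D.⟦⟧-cong (·-as-* k y) ⟨
        D (k · y)                              ≈⟨ ·-homo D-additive k y ⟩
        k · D y                                ≈⟨ ·-as-* k (D y) ⟩
        (k · 1#) * D y                         ≈⟨ *-congʳ (·-congʳ k σ.1#-homo) ⟨
        (k · σ 1#) * D y                       ≈⟨ *-congʳ (·-homo σ.+-isGroupHomomorphism k 1#) ⟨
        σ (k · 1#) * D y                       ≈⟨ +-identityˡ _ ⟨
        0# + σ (k · 1#) * D y                  ≈⟨ +-congʳ (trans (*-congʳ (D-·1≈0 k)) (zeroˡ _)) ⟨
        D (k · 1#) * τ y + σ (k · 1#) * D y    ∎

      leibniz-1ˡ : ∀ y → LeibnizAt 1# y
      -- `(+ 1) · 1#` unfolds to `1# + 0#`.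
      leibniz-1ˡ y = leibniz-cong (+-identityʳ 1#) refl (leibniz-·1ˡ (+ 1) y)

      leibniz-1ʳ : ∀ x → LeibnizAt x 1#
      leibniz-1ʳ x = begin
        D (x * 1#)               ≈⟨ D.⟦⟧-cong (*-identityʳ x) ⟩
        D x                      ≈⟨ *-identityʳ _ ⟨
        D x * 1#                 ≈⟨ *-congˡ τ.1#-homo ⟨
        D x * τ 1#               ≈⟨ +-identityʳ _ ⟨
        D x * τ 1# + 0#          ≈⟨ +-congˡ (trans (*-congˡ D1≈0) (zeroʳ _)) ⟨
        D x * τ 1# + σ x * D 1#  ∎

      leibniz-+ˡ : ∀ {x x′ y} → LeibnizAt x y → LeibnizAt x′ y → LeibnizAt (x + x′) y
      leibniz-+ˡ {x} {x′} {y} l l′ = begin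
        D ((x + x′) * y)       ≈⟨ D.⟦⟧-cong (distribʳ y x x′) ⟩
        D (x * y + x′ * y)     ≈⟨ D.homo _ _ ⟩
        D (x * y) + D (x′ * y) ≈⟨ +-cong l l′ ⟩
        (D x * τ y + σ x * D y) + (D x′ * τ y + σ x′ * D y)
          ≈⟨ solve 6 (λ a b c d e f → (a :* e :+ b :* f) :+ (c :* e :+ d :* f)
                                   := (a :+ c) :* e :+ (b :+ d) :* f)
               refl (D x) (σ x) (D x′) (σ x′) (τ y) (D y) ⟩
        (D x + D x′) * τ y + (σ x + σ x′) * D y
          ≈⟨ +-cong (*-congʳ (D.homo x x′)) (*-congʳ (σ.+-homo x x′)) ⟨
        D (x + x′) * τ y + σ (x + x′) * D y ∎

      leibniz-+ʳ : ∀ {x y y′} → LeibnizAt x y → LeibnizAt x y′ → LeibnizAt x (y + y′)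
      leibniz-+ʳ {x} {y} {y′} l l′ = begin
        D (x * (y + y′))       ≈⟨ D.⟦⟧-cong (distribˡ x y y′) ⟩
        D (x * y + x * y′)     ≈⟨ D.homo _ _ ⟩
        D (x * y) + D (x * y′) ≈⟨ +-cong l l′ ⟩
        (D x * τ y + σ x * D y) + (D x * τ y′ + σ x * D y′)
          ≈⟨ solve 6 (λ a b c d e f → (e :* a :+ f :* b) :+ (e :* c :+ f :* d)
                                   := e :* (a :+ c) :+ f :* (b :+ d))
               refl (τ y) (D y) (τ y′) (D y′) (D x) (σ x) ⟩
        D x * (τ y + τ y′) + σ x * (D y + D y′)
          ≈⟨ +-cong (*-congˡ (τ.+-homo y y′)) (*-congˡ (D.homo y y′)) ⟨
        D x * τ (y + y′) + σ x * D (y + y′) ∎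

      leibniz-negˡ : ∀ {x y} → LeibnizAt x y → LeibnizAt (- x) y
      leibniz-negˡ {x} {y} l = begin
        D (- x * y)                      ≈⟨ D.⟦⟧-cong (-‿distribˡ-* x y) ⟨
        D (- (x * y))                    ≈⟨ D.⁻¹-homo _ ⟩
        - D (x * y)                      ≈⟨ -‿cong l ⟩
        - (D x * τ y + σ x * D y)        ≈⟨ -‿+-comm _ _ ⟨
        - (D x * τ y) + - (σ x * D y)    ≈⟨ +-cong (-‿distribˡ-* _ _) (-‿distribˡ-* _ _) ⟩
        - D x * τ y + - σ x * D y        ≈⟨ +-cong (*-congʳ (D.⁻¹-homo x)) (*-congʳ (σ.-‿homo x)) ⟨
        D (- x) * τ y + σ (- x) * D y    ∎

      leibniz-negʳ : ∀ {x y} → LeibnizAt x y → LeibnizAt x (- y)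
      leibniz-negʳ {x} {y} l = begin
        D (x * - y)                      ≈⟨ D.⟦⟧-cong (-‿distribʳ-* x y) ⟨
        D (- (x * y))                    ≈⟨ D.⁻¹-homo _ ⟩
        - D (x * y)                      ≈⟨ -‿cong l ⟩
        - (D x * τ y + σ x * D y)        ≈⟨ -‿+-comm _ _ ⟨
        - (D x * τ y) + - (σ x * D y)    ≈⟨ +-cong (-‿distribʳ-* _ _) (-‿distribʳ-* _ _) ⟩
        D x * - τ y + σ x * - D y        ≈⟨ +-cong (*-congˡ (τ.-‿homo y)) (*-congˡ (D.⁻¹-homo y)) ⟨
        D x * τ (- y) + σ x * D (- y)    ∎

      -- Writing c(x,y) for the defect D(xy) - D x · τ y - σ x · D y, associativity gives c(xy,z) +
      -- c(x,y) · τ z = c(x,yz) + σ x · c(y,z). If three of these defects vanish, so does c(x,yz).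
      leibniz-assocʳ : ∀ {x y z} →
        LeibnizAt x y → LeibnizAt y z → LeibnizAt (x * y) z → LeibnizAt x (y * z)
      leibniz-assocʳ {x} {y} {z} lxy lyz lxy,z = begin
        D (x * (y * z))                                 ≈⟨ D.⟦⟧-cong (*-assoc x y z) ⟨
        D (x * y * z)                                   ≈⟨ lxy,z ⟩
        D (x * y) * τ z + σ (x * y) * D z
          ≈⟨ +-cong (*-congʳ lxy) (*-congʳ (σ.*-homo x y)) ⟩
        (D x * τ y + σ x * D y) * τ z + σ x * σ y * D z ≈⟨ cocycle ⟩
        D x * (τ y * τ z) + σ x * (D y * τ z + σ y * D z)
          ≈⟨ +-cong (*-congˡ (τ.*-homo y z)) (*-congˡ lyz) ⟨
        D x * τ (y * z) + σ x * D (y * z)               ∎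
        where
        cocycle = solve 7 (λ a b c d e f g →
            (a :* b :+ c :* d) :* e :+ c :* f :* g := a :* (b :* e) :+ c :* (d :* e :+ f :* g))
          refl (D x) (τ y) (σ x) (D y) (τ z) (σ y) (D z)

      -- The same cocycle identity, solved for c(xy,z).
      leibniz-assocˡ : ∀ {x y z} →
        LeibnizAt x y → LeibnizAt y z → LeibnizAt x (y * z) → LeibnizAt (x * y) z
      leibniz-assocˡ {x} {y} {z} lxy lyz lx,yz = begin
        D (x * y * z)                                     ≈⟨ D.⟦⟧-cong (*-assoc x y z) ⟩
        D (x * (y * z))                                   ≈⟨ lx,yz ⟩
        D x * τ (y * z) + σ x * D (y * z)
          ≈⟨ +-cong (*-congˡ (τ.*-homo y z)) (*-congˡ lyz) ⟩
        D x * (τ y * τ z) + σ x * (D y * τ z + σ y * D z) ≈⟨ cocycle ⟩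
        (D x * τ y + σ x * D y) * τ z + σ x * σ y * D z
          ≈⟨ +-cong (*-congʳ lxy) (*-congʳ (σ.*-homo x y)) ⟨
        D (x * y) * τ z + σ (x * y) * D z                 ∎
        where
        cocycle = solve 7 (λ a b c d e f g →
            a :* (b :* e) :+ c :* (d :* e :+ f :* g) := (a :* b :+ c :* d) :* e :+ c :* f :* g)
          refl (D x) (τ y) (σ x) (D y) (τ z) (σ y) (D z)

      leibniz-fromGenerators :
        LeibnizAt r r → LeibnizAt r s → LeibnizAt s r → LeibnizAt s s → ∀ x y → LeibnizAt x y
      leibniz-fromGenerators lrr lrs lsr lss x y = left (span x) y
        where
        atʳ : ∀ {y} → Span y → LeibnizAt r y
        atʳ one        = leibniz-1ʳ r
        atʳ fst        = lrr
        atʳ snd        = lrs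
        -- The cocycle identity at (r, r, s) applies because `r * r` is an integer, for which the
        -- rule is already known.
        atʳ both       = leibniz-assocʳ lrr lrs (leibniz-cong (sym r²≈m) refl (leibniz-·1ˡ m s))
        atʳ (add p q)  = leibniz-+ʳ (atʳ p) (atʳ q)
        atʳ (neg p)    = leibniz-negʳ (atʳ p)
        atʳ (resp e p) = leibniz-cong refl e (atʳ p)

        atˢ : ∀ {y} → Span y → LeibnizAt s y
        atˢ one        = leibniz-1ʳ s
        atˢ fst        = lsr
        atˢ snd        = lss
        atˢ both       = leibniz-cong refl (*-comm s r)
          (leibniz-assocʳ lss lsr (leibniz-cong (sym s²≈n) refl (leibniz-·1ˡ n r)))
        atˢ (add p q)  = leibniz-+ʳ (atˢ p) (atˢ q)
        atˢ (neg p)    = leibniz-negʳ (atˢ p)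
        atˢ (resp e p) = leibniz-cong refl e (atˢ p)

        left : ∀ {x} → Span x → ∀ y → LeibnizAt x y
        left one        y = leibniz-1ˡ y
        left fst        y = atʳ (span y)
        left snd        y = atˢ (span y)
        -- The pair (rs, y) is reduced to (s, y) and (r, sy). The second argument sy need not be a
        -- generator, so the rows of r and s must be known for every y first.
        left both       y = leibniz-assocˡ lrs (atˢ (span y)) (atʳ (span (s * y)))
        left (add p q)  y = leibniz-+ˡ (left p y) (left q y)
        left (neg p)    y = leibniz-negˡ (left p y)
        left (resp e p) y = leibniz-cong e refl (left p y)

      vanishes : D r ≈ 0# → D s ≈ 0# → D (r * s) ≈ 0# → ∀ x → D x ≈ 0#
      vanishes Dr≈0 Ds≈0 Drs≈0 x = go (span x)
        where
        go : ∀ {x} → Span x → D x ≈ 0#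
        go one        = D1≈0
        go fst        = Dr≈0
        go snd        = Ds≈0
        go both       = Drs≈0
        go (add p q)  = trans (D.homo _ _) (trans (+-cong (go p) (go q)) (+-identityˡ 0#))
        go (neg p)    = trans (D.⁻¹-homo _) (trans (-‿cong (go p)) -0#≈0#)
        go (resp e p) = trans (D.⟦⟧-cong (sym e)) (go p)

    -- Signs of the endomorphisms on the roots, and the three cases.

    module Classification (span : ∀ x → Span x)
      (*-cancel-0 : ∀ {x y} → x * y ≈ 0# → x ≉ 0# → y ≈ 0#)
      (≈0? : ∀ x → Dec (x ≈ 0#))
      (double-0 : ∀ {x} → x + x ≈ 0# → x ≈ 0#)
      (r≉0 : r ≉ 0#) (s≉0 : s ≉ 0#)
      where

      EqualUpToSign : Carrier → Carrier → Set ℓ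
      EqualUpToSign x y = x ≈ y ⊎ x ≈ - y

      -- From (x - y)(x + y) = 0, deciding whether x - y vanishes tells which sign to choose.
      squares-≈ : ∀ {x y} → x * x ≈ y * y → EqualUpToSign x y
      squares-≈ {x} {y} x²≈y² with ≈0? (x + - y)
      ... | yes x-y≈0 = inj₁ (x∙y⁻¹≈ε⇒x≈y x y x-y≈0)
      ... | no  x-y≉0 = inj₂ (inverseˡ-unique x y (*-cancel-0 product x-y≉0))
        where
        product : (x + - y) * (x + y) ≈ 0#
        product = begin
          (x + - y) * (x + y)
            -- The solver knows only semirings, so `- y` enters as an independent variable.
            ≈⟨ solve 3 (λ x y z → (x :+ z) :* (x :+ y) := x :* x :+ z :* y :+ x :* (y :+ z))
                 refl x y (- y) ⟩
          x * x + - y * y + x * (y + - y)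
            ≈⟨ +-cong (+-cong x²≈y² (sym (-‿distribˡ-* y y))) (*-congˡ (-‿inverseʳ y)) ⟩
          y * y + - (y * y) + x * 0#
            ≈⟨ +-cong (-‿inverseʳ _) (zeroʳ x) ⟩
          0# + 0#  ≈⟨ +-identityˡ 0# ⟩
          0#       ∎

      -- Adding the two equations gives 2x = 0. They arise with x = D(rs), y = σ s · D r and z = σ r
      -- · D s, as the Leibniz rules at (r, s) and (s, r) when τ is opposite to σ on both roots.
      double-cancel : ∀ {x y z} → x ≈ - y + z → x ≈ - z + y → x ≈ 0# × z ≈ y
      double-cancel {x} {y} {z} x≈z-y x≈y-z = x≈0 , (begin
        z             ≈⟨ +-identityˡ z ⟨
        0# + z        ≈⟨ +-congʳ (-‿inverseʳ y) ⟨
        y + - y + z   ≈⟨ +-assoc y (- y) z ⟩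
        y + (- y + z) ≈⟨ +-congˡ (trans (sym x≈z-y) x≈0) ⟩
        y + 0#        ≈⟨ +-identityʳ y ⟩
        y             ∎)
        where
        x≈0 : x ≈ 0#
        x≈0 = double-0 (begin
          x + x                        ≈⟨ +-cong x≈z-y x≈y-z ⟩
          (- y + z) + (- z + y)
            ≈⟨ solve 4 (λ y z y′ z′ → (y′ :+ z) :+ (z′ :+ y) := (y :+ y′) :+ (z :+ z′))
                 refl y z (- y) (- z) ⟩
          (y + - y) + (z + - z)        ≈⟨ +-cong (-‿inverseʳ y) (-‿inverseʳ z) ⟩
          0# + 0#                      ≈⟨ +-identityˡ 0# ⟩
          0#                           ∎)

      module _ (f : Carrier → Carrier) where
        open RingWithoutOneMorphisms
          (RawRing.rawRingWithoutOne rawRing) (RawRing.rawRingWithoutOne rawRing)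

        NonZeroEndomorphism : Set (c ⊔ ℓ)
        NonZeroEndomorphism = IsRingWithoutOneHomomorphism f × ¬ (∀ x → f x ≈ 0#)

        -- The element f 1 is idempotent, and it is non-zero because f x = f 1 · f x. Cancelling it
        -- in f 1 · (f 1 - 1) = 0 gives f 1 = 1.
        unital : NonZeroEndomorphism → RingMorphisms.IsRingHomomorphism rawRing rawRing f
        unital (f-homo , f≉0) = record
          { isSemiringHomomorphism = record
            { isNearSemiringHomomorphism = record
              { +-isMonoidHomomorphism = f.+-isMonoidHomomorphism
              ; *-homo = f.*-homo
              }
            ; 1#-homo = x∙y⁻¹≈ε⇒x≈y _ _ (*-cancel-0 idempotent f1≉0)
            }
          ; -‿homo = GroupMorphisms.IsGroupHomomorphism.⁻¹-homo f.+-isGroupHomomorphism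
          }
          where
          module f = IsRingWithoutOneHomomorphism f-homo
          f1≉0 : f 1# ≉ 0#
          f1≉0 f1≈0 = f≉0 λ x → begin
            f x         ≈⟨ f.⟦⟧-cong (*-identityˡ x) ⟨
            f (1# * x)  ≈⟨ f.*-homo 1# x ⟩
            f 1# * f x  ≈⟨ *-congʳ f1≈0 ⟩
            0# * f x    ≈⟨ zeroˡ _ ⟩
            0#          ∎
          idempotent : f 1# * (f 1# + - 1#) ≈ 0#
          idempotent = begin
            f 1# * (f 1# + - 1#)          ≈⟨ distribˡ _ _ _ ⟩
            f 1# * f 1# + f 1# * - 1#     ≈⟨ +-cong (f.*-homo 1# 1#) (-‿distribʳ-* _ _) ⟨
            f (1# * 1#) + - (f 1# * 1#)
              ≈⟨ +-cong (f.⟦⟧-cong (*-identityʳ 1#)) (-‿cong (*-identityʳ _)) ⟩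
            f 1# + - f 1#                 ≈⟨ -‿inverseʳ _ ⟩
            0#                            ∎

        module _ (f-homo : RingMorphisms.IsRingHomomorphism rawRing rawRing f) where
          private module f = RingMorphisms.IsRingHomomorphism f-homo

          -- A unital endomorphism fixes integers, so f x and x have the same square.
          sign : ∀ k {x} → x * x ≈ k · 1# → EqualUpToSign (f x) x
          sign k {x} x²≈k = squares-≈ (begin
            f x * f x  ≈⟨ f.*-homo x x ⟨
            f (x * x)  ≈⟨ f.⟦⟧-cong x²≈k ⟩
            f (k · 1#) ≈⟨ ·-homo f.+-isGroupHomomorphism k 1# ⟩
            k · f 1#   ≈⟨ ·-congʳ k f.1#-homo ⟩
            k · 1#     ≈⟨ x²≈k ⟨
            x * x      ∎)

      neg-cong-involutive : ∀ {x y z} → x ≈ - y → y ≈ - z → x ≈ z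
      neg-cong-involutive x≈-y y≈-z = trans x≈-y (trans (-‿cong y≈-z) (-‿involutive _))

      opposite-sym : ∀ {x y} → x ≈ - y → y ≈ - x
      opposite-sym x≈-y = sym (neg-cong-involutive refl x≈-y)

      signs-comparable : ∀ {x y z} → EqualUpToSign x z → EqualUpToSign y z → EqualUpToSign y x
      signs-comparable (inj₁ x≈z)  (inj₁ y≈z)  = inj₁ (trans y≈z (sym x≈z))
      signs-comparable (inj₁ x≈z)  (inj₂ y≈-z) = inj₂ (trans y≈-z (-‿cong (sym x≈z)))
      signs-comparable (inj₂ x≈-z) (inj₁ y≈z)  = inj₂ (trans y≈z (opposite-sym x≈-z))
      signs-comparable (inj₂ x≈-z) (inj₂ y≈-z) = inj₁ (trans y≈-z (sym x≈-z))

      sign-≉0 : ∀ {x y} → EqualUpToSign x y → y ≉ 0# → x ≉ 0#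
      sign-≉0 (inj₁ x≈y)  y≉0 x≈0 = y≉0 (trans (sym x≈y) x≈0)
      sign-≉0 (inj₂ x≈-y) y≉0 x≈0 =
        y≉0 (trans (opposite-sym x≈-y) (trans (-‿cong x≈0) -0#≈0#))

      module _ {σ τ D : Carrier → Carrier}
        (σ-homo : RingMorphisms.IsRingHomomorphism rawRing rawRing σ)
        (τ-homo : RingMorphisms.IsRingHomomorphism rawRing rawRing τ)
        (D-additive : IsAdditive D) (D1≈0 : D 1# ≈ 0#) (D≉0 : ¬ (∀ x → D x ≈ 0#))
        where

        open Leibniz span σ-homo τ-homo D-additive D1≈0
        private module D = GroupMorphisms.IsGroupHomomorphism D-additive

        Dsr≈Drs : D (s * r) ≈ D (r * s)
        Dsr≈Drs = D.⟦⟧-cong (*-comm s r)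

        GeneratorsLeibniz : Set ℓ
        GeneratorsLeibniz = LeibnizAt r r × LeibnizAt r s × LeibnizAt s r × LeibnizAt s s

        Acts : (Carrier → Carrier) → Carrier → Carrier → Set ℓ
        Acts f x y = f r ≈ x × f s ≈ y

        Pair : (x y x′ y′ : Carrier) → Set ℓ
        Pair x y x′ y′ = (Acts σ x y × Acts τ x′ y′) ⊎ (Acts σ x′ y′ × Acts τ x y)

        Case₁ Case₂ Case₃ : Set ℓ
        Case₁ = D r ≈ 0# × D s ≉ 0# × D (r * s) ≉ 0# ×
          ( (Pair r s r (- s) × D (r * s) ≈ r * D s)
          ⊎ (Pair (- r) s (- r) (- s) × D (r * s) ≈ - r * D s))
        Case₂ = D r ≉ 0# × D s ≈ 0# × D (r * s) ≉ 0# ×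
          ( (Pair r s (- r) s × D (r * s) ≈ s * D r)
          ⊎ (Pair r (- s) (- r) (- s) × D (r * s) ≈ - s * D r))
        Case₃ = D r ≉ 0# × D s ≉ 0# × D (r * s) ≈ 0# ×
          ( (Pair r s (- r) (- s) × r * D s ≈ s * D r)
          ⊎ (Pair r (- s) (- r) s × r * D s ≈ - s * D r))

        -- The same cases with the signs of τ and D read relative to σ, so that the four
        -- pairs (σ , τ) allowed in a case satisfy the same equations.
        Opposite₁ Opposite₂ Opposite₃ : Set ℓ
        Opposite₁ = τ r ≈ σ r   × τ s ≈ - σ s × D (r * s) ≈ σ r * D s
        Opposite₂ = τ r ≈ - σ r × τ s ≈ σ s   × D (r * s) ≈ σ s * D r
        Opposite₃ = τ r ≈ - σ r × τ s ≈ - σ s × σ r * D s ≈ σ s * D r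

        σr-sign : EqualUpToSign (σ r) r
        σr-sign = sign σ σ-homo m r²≈m

        σs-sign : EqualUpToSign (σ s) s
        σs-sign = sign σ σ-homo n s²≈n

        private
          -- In the third case a minus sign can occur on both sides of the relation between D r and
          -- D s; this removes or inserts the pair.
          neg-both : ∀ {x y u v} → x ≈ - u → y ≈ - v → ∀ {p q} → (x * p ≈ y * q) ⇔ (u * p ≈ v * q)
          neg-both {x} {y} {u} {v} x≈-u y≈-v {p} {q} = mk⇔
            (λ e → trans (sym (lemma x≈-u)) (trans (-‿cong e) (lemma y≈-v)))
            (λ e → trans (lemma′ x≈-u) (trans (-‿cong e) (sym (lemma′ y≈-v))))
            where
            lemma′ : ∀ {x u p} → x ≈ - u → x * p ≈ - (u * p)
            lemma′ x≈-u = trans (*-congʳ x≈-u) (sym (-‿distribˡ-* _ _))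
            lemma : ∀ {x u p} → x ≈ - u → - (x * p) ≈ u * p
            lemma x≈-u = neg-cong-involutive refl (lemma′ x≈-u)

          agree : ∀ {x y u} → x ≈ u → y ≈ u → y ≈ x
          agree x≈u y≈u = trans y≈u (sym x≈u)

          oppose : ∀ {x y u} → x ≈ u → y ≈ - u → y ≈ - x
          oppose x≈u y≈-u = trans y≈-u (-‿cong (sym x≈u))

          oppose′ : ∀ {x y u} → x ≈ - u → y ≈ u → y ≈ - x
          oppose′ x≈-u y≈u = opposite-sym (oppose y≈u x≈-u)

        -- In each alternative the sign before `r` in the formula for D(rs) is the sign of σ on r.
        case₁⇒opposite₁ : Case₁ → Opposite₁
        case₁⇒opposite₁ (_ , _ , _ , inj₁ (inj₁ ((σr , σs) , (τr , τs)) , e)) =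
          agree σr τr , oppose σs τs , trans e (*-congʳ (sym σr))
        case₁⇒opposite₁ (_ , _ , _ , inj₁ (inj₂ ((σr , σs) , (τr , τs)) , e)) =
          agree σr τr , oppose′ σs τs , trans e (*-congʳ (sym σr))
        case₁⇒opposite₁ (_ , _ , _ , inj₂ (inj₁ ((σr , σs) , (τr , τs)) , e)) =
          agree σr τr , oppose σs τs , trans e (*-congʳ (sym σr))
        case₁⇒opposite₁ (_ , _ , _ , inj₂ (inj₂ ((σr , σs) , (τr , τs)) , e)) =
          agree σr τr , oppose′ σs τs , trans e (*-congʳ (sym σr))

        case₂⇒opposite₂ : Case₂ → Opposite₂
        case₂⇒opposite₂ (_ , _ , _ , inj₁ (inj₁ ((σr , σs) , (τr , τs)) , e)) =
          oppose σr τr , agree σs τs , trans e (*-congʳ (sym σs))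
        case₂⇒opposite₂ (_ , _ , _ , inj₁ (inj₂ ((σr , σs) , (τr , τs)) , e)) =
          oppose′ σr τr , agree σs τs , trans e (*-congʳ (sym σs))
        case₂⇒opposite₂ (_ , _ , _ , inj₂ (inj₁ ((σr , σs) , (τr , τs)) , e)) =
          oppose σr τr , agree σs τs , trans e (*-congʳ (sym σs))
        case₂⇒opposite₂ (_ , _ , _ , inj₂ (inj₂ ((σr , σs) , (τr , τs)) , e)) =
          oppose′ σr τr , agree σs τs , trans e (*-congʳ (sym σs))

        -- The sign in the relation between D r and D s is the product of the signs of σ on r and on
        -- s.
        case₃⇒opposite₃ : Case₃ → Opposite₃
        case₃⇒opposite₃ (_ , _ , _ , inj₁ (inj₁ ((σr , σs) , (τr , τs)) , e)) =
          oppose σr τr , oppose σs τs , trans (*-congʳ σr) (trans e (*-congʳ (sym σs)))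
        case₃⇒opposite₃ (_ , _ , _ , inj₁ (inj₂ ((σr , σs) , (τr , τs)) , e)) =
          oppose′ σr τr , oppose′ σs τs , Equivalence.from (neg-both σr σs) e
        case₃⇒opposite₃ (_ , _ , _ , inj₂ (inj₁ ((σr , σs) , (τr , τs)) , e)) =
          oppose σr τr , oppose′ σs τs , trans (*-congʳ σr) (trans e (*-congʳ (sym σs)))
        case₃⇒opposite₃ (_ , _ , _ , inj₂ (inj₂ ((σr , σs) , (τr , τs)) , e)) =
          oppose′ σr τr , oppose σs τs ,
          -- Here σ fixes s while the relation contains `- s`, so s is read as the negative of
          -- `- s`.
          Equivalence.from (neg-both σr (trans σs (sym (-‿involutive s)))) e

        -- The sign of σ on r selects the alternative, and its sign on s the order within the pair.
        opposite₁⇒case₁ : D r ≈ 0# → D s ≉ 0# → D (r * s) ≉ 0# → Opposite₁ → Case₁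
        opposite₁⇒case₁ Dr≈0 Ds≉0 Drs≉0 (τr≈σr , τs≈-σs , e) =
          Dr≈0 , Ds≉0 , Drs≉0 , alternatives σr-sign σs-sign
          where
          alternatives : EqualUpToSign (σ r) r → EqualUpToSign (σ s) s → _
          alternatives (inj₁ σr) (inj₁ σs) = inj₁
            (inj₁ ((σr , σs) , (trans τr≈σr σr , trans τs≈-σs (-‿cong σs))) , trans e (*-congʳ σr))
          alternatives (inj₁ σr) (inj₂ σs) = inj₁
            (inj₂ ((σr , σs) , (trans τr≈σr σr , neg-cong-involutive τs≈-σs σs)) ,
             trans e (*-congʳ σr))
          alternatives (inj₂ σr) (inj₁ σs) = inj₂
            (inj₁ ((σr , σs) , (trans τr≈σr σr , trans τs≈-σs (-‿cong σs))) , trans e (*-congʳ σr))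
          alternatives (inj₂ σr) (inj₂ σs) = inj₂
            (inj₂ ((σr , σs) , (trans τr≈σr σr , neg-cong-involutive τs≈-σs σs)) ,
             trans e (*-congʳ σr))

        -- Now the sign on s selects the alternative, and the sign on r the order.
        opposite₂⇒case₂ : D r ≉ 0# → D s ≈ 0# → D (r * s) ≉ 0# → Opposite₂ → Case₂
        opposite₂⇒case₂ Dr≉0 Ds≈0 Drs≉0 (τr≈-σr , τs≈σs , e) =
          Dr≉0 , Ds≈0 , Drs≉0 , alternatives σr-sign σs-sign
          where
          alternatives : EqualUpToSign (σ r) r → EqualUpToSign (σ s) s → _
          alternatives (inj₁ σr) (inj₁ σs) = inj₁
            (inj₁ ((σr , σs) , (trans τr≈-σr (-‿cong σr) , trans τs≈σs σs)) , trans e (*-congʳ σs))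
          alternatives (inj₂ σr) (inj₁ σs) = inj₁
            (inj₂ ((σr , σs) , (neg-cong-involutive τr≈-σr σr , trans τs≈σs σs)) ,
             trans e (*-congʳ σs))
          alternatives (inj₁ σr) (inj₂ σs) = inj₂
            (inj₁ ((σr , σs) , (trans τr≈-σr (-‿cong σr) , trans τs≈σs σs)) , trans e (*-congʳ σs))
          alternatives (inj₂ σr) (inj₂ σs) = inj₂
            (inj₂ ((σr , σs) , (neg-cong-involutive τr≈-σr σr , trans τs≈σs σs)) ,
             trans e (*-congʳ σs))

        -- Equality of the two signs selects the alternative, and the sign on r the order.
        opposite₃⇒case₃ : D r ≉ 0# → D s ≉ 0# → D (r * s) ≈ 0# → Opposite₃ → Case₃
        opposite₃⇒case₃ Dr≉0 Ds≉0 Drs≈0 (τr≈-σr , τs≈-σs , e) =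
          Dr≉0 , Ds≉0 , Drs≈0 , alternatives σr-sign σs-sign
          where
          alternatives : EqualUpToSign (σ r) r → EqualUpToSign (σ s) s → _
          alternatives (inj₁ σr) (inj₁ σs) = inj₁
            (inj₁ ((σr , σs) , (trans τr≈-σr (-‿cong σr) , trans τs≈-σs (-‿cong σs))) ,
             trans (*-congʳ (sym σr)) (trans e (*-congʳ σs)))
          alternatives (inj₂ σr) (inj₂ σs) = inj₁
            (inj₂ ((σr , σs) , (neg-cong-involutive τr≈-σr σr , neg-cong-involutive τs≈-σs σs)) ,
             Equivalence.to (neg-both σr σs) e)
          alternatives (inj₁ σr) (inj₂ σs) = inj₂
            (inj₁ ((σr , σs) , (trans τr≈-σr (-‿cong σr) , neg-cong-involutive τs≈-σs σs)) ,
             trans (*-congʳ (sym σr)) (trans e (*-congʳ σs)))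
          alternatives (inj₂ σr) (inj₁ σs) = inj₂
            (inj₂ ((σr , σs) , (neg-cong-involutive τr≈-σr σr , trans τs≈-σs (-‿cong σs))) ,
             Equivalence.to (neg-both σr (trans σs (sym (-‿involutive s)))) e)

        -- The Leibniz rule at pairs of roots, in terms of relative signs.

        module _ {x : Carrier} (Dx²≈0 : D (x * x) ≈ 0#) where

          -- The rule at (x, x) reads 0 = 2 · σ x · D x, and both 2 and σ x can be cancelled.
          agree⇒D≈0 : LeibnizAt x x → τ x ≈ σ x → σ x ≉ 0# → D x ≈ 0#
          agree⇒D≈0 lxx τx≈σx σx≉0 = *-cancel-0 (double-0 (begin
            σ x * D x + σ x * D x ≈⟨ +-congʳ (trans (*-comm _ _) (*-congˡ (sym τx≈σx))) ⟩
            D x * τ x + σ x * D x ≈⟨ lxx ⟨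
            D (x * x)             ≈⟨ Dx²≈0 ⟩
            0#                    ∎)) σx≉0

          D≈0⇒leibniz : D x ≈ 0# → LeibnizAt x x
          D≈0⇒leibniz Dx≈0 = begin
            D (x * x)             ≈⟨ Dx²≈0 ⟩
            0#                    ≈⟨ +-identityˡ 0# ⟨
            0# + 0#
              ≈⟨ +-cong (trans (*-congʳ Dx≈0) (zeroˡ _)) (trans (*-congˡ Dx≈0) (zeroʳ _)) ⟨
            D x * τ x + σ x * D x ∎

          -- The two summands cancel, so the rule puts no condition on D x.
          oppose⇒leibniz : τ x ≈ - σ x → LeibnizAt x x
          oppose⇒leibniz τx≈-σx = begin
            D (x * x)                     ≈⟨ Dx²≈0 ⟩
            0#                            ≈⟨ -‿inverseˡ _ ⟨
            - (D x * σ x) + D x * σ x     ≈⟨ +-cong (-‿distribʳ-* _ _) (*-comm _ _) ⟩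
            D x * - σ x + σ x * D x       ≈⟨ +-congʳ (*-congˡ τx≈-σx) ⟨
            D x * τ x + σ x * D x         ∎

        D≈0⇒leibnizʳ : ∀ {x y} → D x ≈ 0# → D (x * y) ≈ σ x * D y → LeibnizAt x y
        D≈0⇒leibnizʳ {x} {y} Dx≈0 e = begin
          D (x * y)             ≈⟨ e ⟩
          σ x * D y             ≈⟨ +-identityˡ _ ⟨
          0# + σ x * D y        ≈⟨ +-congʳ (trans (*-congʳ Dx≈0) (zeroˡ _)) ⟨
          D x * τ y + σ x * D y ∎

        D≈0⇒leibnizˡ : ∀ {x y} → D y ≈ 0# → D (x * y) ≈ D x * τ y → LeibnizAt x y
        D≈0⇒leibnizˡ {x} {y} Dy≈0 e = begin
          D (x * y)             ≈⟨ e ⟩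
          D x * τ y             ≈⟨ +-identityʳ _ ⟨
          D x * τ y + 0#        ≈⟨ +-congˡ (trans (*-congˡ Dy≈0) (zeroʳ _)) ⟨
          D x * τ y + σ x * D y ∎

        D≈0∧leibniz⇒D* : ∀ {x y} → D x ≈ 0# → LeibnizAt x y → D (x * y) ≈ σ x * D y
        D≈0∧leibniz⇒D* Dx≈0 l =
          trans l (trans (+-congʳ (trans (*-congʳ Dx≈0) (zeroˡ _))) (+-identityˡ _))

        oppose∧leibniz⇒D* : ∀ {x y} → τ y ≈ - σ y → LeibnizAt x y →
          D (x * y) ≈ - (σ y * D x) + σ x * D y
        oppose∧leibniz⇒D* τy≈-σy l = trans l
          (+-congʳ (trans (*-congˡ τy≈-σy) (trans (sym (-‿distribʳ-* _ _)) (-‿cong (*-comm _ _)))))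

        oppose⇒leibniz-pair : ∀ {x y} → τ y ≈ - σ y → σ x * D y ≈ σ y * D x →
          D (x * y) ≈ 0# → LeibnizAt x y
        oppose⇒leibniz-pair {x} {y} τy≈-σy e Dxy≈0 = begin
          D (x * y)                   ≈⟨ Dxy≈0 ⟩
          0#                          ≈⟨ -‿inverseˡ _ ⟨
          - (D x * σ y) + D x * σ y   ≈⟨ +-cong (-‿distribʳ-* _ _) (trans (*-comm _ _) (sym e)) ⟩
          D x * - σ y + σ x * D y     ≈⟨ +-congʳ (*-congˡ τy≈-σy) ⟨
          D x * τ y + σ x * D y       ∎

        cases⇒leibniz : Case₁ ⊎ Case₂ ⊎ Case₃ → GeneratorsLeibniz
        cases⇒leibniz (inj₁ c@(Dr≈0 , _)) with case₁⇒opposite₁ c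
        ... | τr≈σr , τs≈-σs , e =
          D≈0⇒leibniz D-r²≈0 Dr≈0 ,
          D≈0⇒leibnizʳ Dr≈0 e ,
          -- At (s, r) the surviving summand is D s · τ r, which equals σ r · D s because τ and σ
          -- agree on r.
          D≈0⇒leibnizˡ Dr≈0 (trans Dsr≈Drs (trans e (trans (*-comm _ _) (*-congˡ (sym τr≈σr))))) ,
          oppose⇒leibniz D-s²≈0 τs≈-σs
        cases⇒leibniz (inj₂ (inj₁ c@(_ , Ds≈0 , _))) with case₂⇒opposite₂ c
        ... | τr≈-σr , τs≈σs , e =
          oppose⇒leibniz D-r²≈0 τr≈-σr ,
          D≈0⇒leibnizˡ Ds≈0 (trans e (trans (*-comm _ _) (*-congˡ (sym τs≈σs)))) ,
          D≈0⇒leibnizʳ Ds≈0 (trans Dsr≈Drs e) ,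
          D≈0⇒leibniz D-s²≈0 Ds≈0
        cases⇒leibniz (inj₂ (inj₂ c@(_ , _ , Drs≈0 , _))) with case₃⇒opposite₃ c
        ... | τr≈-σr , τs≈-σs , e =
          oppose⇒leibniz D-r²≈0 τr≈-σr ,
          oppose⇒leibniz-pair τs≈-σs e Drs≈0 ,
          oppose⇒leibniz-pair τr≈-σr (sym e) (trans Dsr≈Drs Drs≈0) ,
          oppose⇒leibniz D-s²≈0 τs≈-σs

        -- Agreement of σ and τ on a root forces D to vanish there. Each required non-vanishing
        -- holds because its failure would make D zero at r, s and rs, hence everywhere.
        leibniz⇒cases : GeneratorsLeibniz → Case₁ ⊎ Case₂ ⊎ Case₃
        leibniz⇒cases (lrr , lrs , lsr , lss) = byAgreement
          (signs-comparable σr-sign (sign τ τ-homo m r²≈m))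
          (signs-comparable σs-sign (sign τ τ-homo n s²≈n))
          where
          σr≉0 = sign-≉0 σr-sign r≉0
          σs≉0 = sign-≉0 σs-sign s≉0

          *-zero-cong : ∀ {x y z} → x ≈ y * z → z ≈ 0# → x ≈ 0#
          *-zero-cong x≈yz z≈0 = trans x≈yz (trans (*-congˡ z≈0) (zeroʳ _))

          byAgreement : EqualUpToSign (τ r) (σ r) → EqualUpToSign (τ s) (σ s) →
            Case₁ ⊎ Case₂ ⊎ Case₃
          byAgreement (inj₁ τr≈σr) (inj₁ τs≈σs) =
            ⊥-elim (D≉0 (vanishes Dr≈0 Ds≈0 (*-zero-cong (D≈0∧leibniz⇒D* Dr≈0 lrs) Ds≈0)))
            where
            Dr≈0 = agree⇒D≈0 D-r²≈0 lrr τr≈σr σr≉0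
            Ds≈0 = agree⇒D≈0 D-s²≈0 lss τs≈σs σs≉0
          byAgreement (inj₁ τr≈σr) (inj₂ τs≈-σs) =
            inj₁ (opposite₁⇒case₁ Dr≈0 Ds≉0 (λ Drs≈0 → Ds≉0 (*-cancel-0 (trans (sym e) Drs≈0) σr≉0))
              (τr≈σr , τs≈-σs , e))
            where
            Dr≈0 = agree⇒D≈0 D-r²≈0 lrr τr≈σr σr≉0
            e = D≈0∧leibniz⇒D* Dr≈0 lrs
            Ds≉0 : D s ≉ 0#
            Ds≉0 Ds≈0 = D≉0 (vanishes Dr≈0 Ds≈0 (*-zero-cong e Ds≈0))
          byAgreement (inj₂ τr≈-σr) (inj₁ τs≈σs) =
            inj₂ (inj₁ (opposite₂⇒case₂ Dr≉0 Ds≈0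
              (λ Drs≈0 → Dr≉0 (*-cancel-0 (trans (sym e) Drs≈0) σs≉0)) (τr≈-σr , τs≈σs , e)))
            where
            Ds≈0 = agree⇒D≈0 D-s²≈0 lss τs≈σs σs≉0
            e = trans (sym Dsr≈Drs) (D≈0∧leibniz⇒D* Ds≈0 lsr)
            Dr≉0 : D r ≉ 0#
            Dr≉0 Dr≈0 = D≉0 (vanishes Dr≈0 Ds≈0 (*-zero-cong e Dr≈0))
          byAgreement (inj₂ τr≈-σr) (inj₂ τs≈-σs)
            with double-cancel (oppose∧leibniz⇒D* τs≈-σs lrs)
                 (trans (sym Dsr≈Drs) (oppose∧leibniz⇒D* τr≈-σr lsr))
          ... | Drs≈0 , e = inj₂ (inj₂ (opposite₃⇒case₃
            -- The relation σ r · D s = σ s · D r makes D r and D s vanish together.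
            (λ Dr≈0 → D≉0 (vanishes Dr≈0 (*-cancel-0 (*-zero-cong e Dr≈0) σr≉0) Drs≈0))
            (λ Ds≈0 → D≉0 (vanishes (*-cancel-0 (*-zero-cong (sym e) Ds≈0) σs≉0) Ds≈0 Drs≈0))
            Drs≈0 (τr≈-σr , τs≈-σs , e)))

        -- The vanishing or not of D r and D s already separates the cases.
        case-exclusive : Case₁ ⊎ Case₂ ⊎ Case₃ → ExactlyOne Case₁ Case₂ Case₃
        case-exclusive (inj₁ c@(Dr≈0 , _)) =
          inj₁ (c , (λ c₂ → proj₁ c₂ Dr≈0) , (λ c₃ → proj₁ c₃ Dr≈0))
        case-exclusive (inj₂ (inj₁ c@(Dr≉0 , Ds≈0 , _))) =
          inj₂ (inj₁ (Dr≉0 ∘ proj₁ , c , (λ c₃ → proj₁ (proj₂ c₃) Ds≈0)))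
        case-exclusive (inj₂ (inj₂ c@(Dr≉0 , Ds≉0 , _))) =
          inj₂ (inj₂ (Dr≉0 ∘ proj₁ , Ds≉0 ∘ proj₁ ∘ proj₂ , c))

        leibniz⇔exactlyOne : (∀ x y → LeibnizAt x y) ⇔ ExactlyOne Case₁ Case₂ Case₃
        leibniz⇔exactlyOne = mk⇔
          (λ l → case-exclusive (leibniz⇒cases (l r r , l r s , l s r , l s s)))
          λ one → let lrr , lrs , lsr , lss = cases⇒leibniz (someCase one)
                  in leibniz-fromGenerators lrr lrs lsr lss
          where
          someCase : ExactlyOne Case₁ Case₂ Case₃ → Case₁ ⊎ Case₂ ⊎ Case₃
          someCase (inj₁ (c , _))             = inj₁ c
          someCase (inj₂ (inj₁ (_ , c , _)))  = inj₂ (inj₁ c)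
          someCase (inj₂ (inj₂ (_ , _ , c)))  = inj₂ (inj₂ c)

-- Integers as rationals, and square-freeness.

/1≡fromℤ : ∀ k → k / 1 ≡ fromℤ k
-- `k / 1` is normalised through a gcd and does not reduce for a variable `k`, whereas `fromℤ k` has
-- numerator `k` by definition.
/1≡fromℤ k = ℚ.↥p/↧p≡p (fromℤ k)

suc/1 : ∀ k → + suc k / 1 ≡ 1ℚ ℚ.+ (+ k / 1)
suc/1 k = ≡.sym (≡.trans (≡.cong (1ℚ ℚ.+_) (/1≡fromℤ (+ k)))
  (≡.cong (λ i → (+ 1 ℤ.+ i) / 1) (ℤ.*-identityʳ (+ k))))

/1≡0⇒≡0 : ∀ {k} → k / 1 ≡ 0ℚ → k ≡ + 0
/1≡0⇒≡0 {k} e = ≡.cong ℚ.↥_ (≡.trans (≡.sym (/1≡fromℤ k)) e)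

-- The square of 2 divides 0, but 2 is not a unit.
squareFree⇒≢0 : ∀ {k} → SquareFree k → k ≢ + 0
squareFree⇒≢0 sf ≡.refl with () ← sf (+ 2) (4 ℕ.∣0)

-- Cancellation, characteristic zero and decidability in the field K.

module BiquadraticField {m n c ℓ₁ ℓ₂} (F : AdjoinSquareRoots m n c ℓ₁ ℓ₂) where
  open AdjoinSquareRoots F
  open HeytingField K hiding (zero)
  open HeytingProperties heytingCommutativeRing using (1#0; x-0≈x)
  open CommutativeRing (fieldAsCommutativeRing K) using (_≉_; +-monoid)
  open IntegerMultiples (fieldAsCommutativeRing K)
  open RingMorphisms.IsRingHomomorphism ι-homo
  open SetoidReasoning (CommutativeRing.setoid (fieldAsCommutativeRing K))

  1≉0 : 1# ≉ 0#
  1≉0 1≈0 = proj₂ (tight 1# 0#) 1≈0 1#0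

  -- By tightness it suffices to refute `y # 0#`, which would make y invertible and so x zero.
  *-cancel-0 : ∀ {x y} → x * y ≈ 0# → x ≉ 0# → y ≈ 0#
  *-cancel-0 {x} {y} xy≈0 x≉0 = proj₁ (tight y 0#) λ y#0 →
    let y⁻¹ , _ , y*y⁻¹≈1 = #⇒invertible y#0 in x≉0 (begin
      x                    ≈⟨ *-identityʳ x ⟨
      -- The inverse obtained from `y # 0#` is that of y - 0, hence `x-0≈x`.
      x * 1#               ≈⟨ *-congˡ (trans (*-congʳ (sym (x-0≈x y))) y*y⁻¹≈1) ⟨
      x * (y * y⁻¹)        ≈⟨ *-assoc x y y⁻¹ ⟨
      x * y * y⁻¹          ≈⟨ *-congʳ xy≈0 ⟩
      0# * y⁻¹             ≈⟨ zeroˡ y⁻¹ ⟩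
      0#                   ∎)

  ι-/1 : ∀ k → ι (k / 1) ≈ k · 1#
  ι-/1 (+ k) = natural k
    where
    natural : ∀ k → ι (+ k / 1) ≈ (+ k) · 1#
    natural zero    = 0#-homo
    natural (suc k) = begin
      ι (+ suc k / 1)          ≈⟨ ⟦⟧-cong (suc/1 k) ⟩
      ι (1ℚ ℚ.+ (+ k / 1))     ≈⟨ +-homo 1ℚ (+ k / 1) ⟩
      ι 1ℚ + ι (+ k / 1)       ≈⟨ +-cong 1#-homo (natural k) ⟩
      1# + (+ k) · 1#          ∎
  -- `-[1+ k ] / 1` unfolds to the negative of `+ suc k / 1`.
  ι-/1 -[1+ k ] = trans (-‿homo (+ suc k / 1)) (-‿cong (ι-/1 (+ suc k)))

  ι-≉0 : ∀ {q} → q ≢ 0ℚ → ι q ≉ 0#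
  ι-≉0 {q} q≢0 ιq≈0 = 1≉0 (begin
    1#                  ≈⟨ 1#-homo ⟨
    ι 1ℚ                ≈⟨ ⟦⟧-cong (ℚ.*-inverseʳ q) ⟨
    ι (q ℚ.* ℚ.1/ q)    ≈⟨ *-homo q (ℚ.1/ q) ⟩
    ι q * ι (ℚ.1/ q)    ≈⟨ *-congʳ ιq≈0 ⟩
    0# * ι (ℚ.1/ q)     ≈⟨ zeroˡ _ ⟩
    0#                  ∎)
    where instance _ = ℚ.≢-nonZero q≢0

  -- The element 2 is the image of a non-zero rational, hence non-zero in K.
  double-0 : ∀ {x} → x + x ≈ 0# → x ≈ 0#
  double-0 {x} x+x≈0 = *-cancel-0 (begin
    ι (1ℚ ℚ.+ 1ℚ) * x    ≈⟨ *-congʳ (trans (+-homo 1ℚ 1ℚ) (+-cong 1#-homo 1#-homo)) ⟩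
    (1# + 1#) * x        ≈⟨ distribʳ x 1# 1# ⟩
    1# * x + 1# * x      ≈⟨ +-cong (*-identityˡ x) (*-identityˡ x) ⟩
    x + x                ≈⟨ x+x≈0 ⟩
    0#                   ∎) (ι-≉0 λ ())

  root-≉0 : ∀ k {x} → SquareFree k → x * x ≈ ι (k / 1) → x ≉ 0#
  root-≉0 k {x} sf x²≈k x≈0 = ι-≉0 (λ e → squareFree⇒≢0 {k} sf (/1≡0⇒≡0 {k} e)) (begin
    ι (k / 1)  ≈⟨ x²≈k ⟨
    x * x      ≈⟨ *-congʳ x≈0 ⟩
    0# * x     ≈⟨ zeroˡ x ⟩
    0#         ∎)

  module _ {d} (degree : HasDegree d) where
    open MonoidSum +-monoid using (sum-cong-≋; sum-replicate-zero)
    private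
      e = proj₁ degree
      module e = IsℚBasis (proj₂ degree)

    -- An element is zero exactly when all its coordinates in a finite ℚ-basis are, and equality in
    -- ℚ is decidable. This is where the degree enters.
    ≈0? : ∀ x → Dec (x ≈ 0#)
    ≈0? x with e.spanning x
    ... | q , x≈qe with Fin.all? (λ i → q i ℚ.≟ 0ℚ)
    ... | yes q≡0 = yes (begin
      x                            ≈⟨ x≈qe ⟩
      linearCombination K ι q e    ≈⟨ sum-cong-≋ (λ i →
        trans (*-congʳ (trans (⟦⟧-cong (q≡0 i)) 0#-homo)) (zeroˡ (e i))) ⟩
      _                            ≈⟨ sum-replicate-zero d ⟩
      0#                           ∎)
    ... | no  q≢0 = no λ x≈0 → q≢0 (e.independent q (trans (sym x≈qe) x≈0))

-- The order 𝒜 as the span of 1, √m, √n and √m√n.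

module BiquadraticOrder {m n c ℓ₁ ℓ₂} (F : AdjoinSquareRoots m n c ℓ₁ ℓ₂) where
  open AdjoinSquareRoots F
  open Order F using (𝒜; √m; √n)
  private
    module K = HeytingField K
    module 𝒜 = CommutativeRing 𝒜
    module ℤK = IntegerMultiples (fieldAsCommutativeRing K)
  open IntegerMultiples 𝒜
  open BiquadraticField F

  proj₁-·1 : ∀ k → proj₁ (k · 𝒜.1#) ≡ k ℤK.· K.1#
  proj₁-·1 (+ k) = natural k
    where
    natural : ∀ k → proj₁ ((+ k) · 𝒜.1#) ≡ (+ k) ℤK.· K.1#
    natural zero    = ≡.refl
    natural (suc k) = ≡.cong (K.1# K.+_) (natural k)
  proj₁-·1 -[1+ k ] = ≡.cong K.-_ (proj₁-·1 (+ suc k))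

  integral : ∀ k {x} → x K.* x K.≈ ι (k / 1) → x K.* x K.≈ proj₁ (k · 𝒜.1#)
  integral k x²≈k =
    K.trans x²≈k (K.trans (ι-/1 k) (K.reflexive (≡.sym (proj₁-·1 k))))

  √m² : √m 𝒜.* √m 𝒜.≈ m · 𝒜.1#
  √m² = integral m root-m²

  √n² : √n 𝒜.* √n 𝒜.≈ n · 𝒜.1#
  √n² = integral n root-n²

  open Biquadratic.Roots 𝒜 m n √m √n √m² √n²

  -- An element of 𝒜 carries the evidence of its construction from the roots, so recursion on that
  -- evidence suffices; products are handled by `span-*`.
  subring⇒span : ∀ {u} (p : Subring⟨_,_⟩ K root-m root-n u) → Span (u , p)
  subring⇒span gen₁       = fst
  subring⇒span gen₂       = snd
  subring⇒span zero       = span-0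
  subring⇒span one        = one
  subring⇒span (add p q)  = add (subring⇒span p) (subring⇒span q)
  subring⇒span (mul p q)  = span-* (subring⇒span p) (subring⇒span q)
  subring⇒span (neg p)    = neg (subring⇒span p)
  subring⇒span (resp e p) = resp e (subring⇒span p)

  span : ∀ x → Span x
  span (_ , p) = subring⇒span p

theorem3p18 : ∀ {c ℓ₁ ℓ₂} (m n : ℤ) → m ≢ n → SquareFree m → SquareFree n →
    (F : AdjoinSquareRoots m n c ℓ₁ ℓ₂) → AdjoinSquareRoots.HasDegree F 4 →
    let open Order F in
    (σ τ : Carrier → Carrier) → IsNonZeroEndomorphism σ → IsNonZeroEndomorphism τ →
    (D : Carrier → Carrier) → IsℤLinear D → NonZero D → D 1# ≈ 0# →
    IsDerivation σ τ D ⇔ ExactlyOne (CaseI σ τ D) (CaseII σ τ D) (CaseIII σ τ D)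
theorem3p18 m n _ m-sf n-sf F degree σ τ σ-endo τ-endo D D-linear D≉0 D1≈0 = mk⇔
  (λ derivation → Equivalence.to criterion (IsDerivation.leibniz derivation))
  (λ one → record { isℤLinear = D-linear ; leibniz = Equivalence.from criterion one })
  where
  open AdjoinSquareRoots F
  open Order F using (𝒜; √m; √n; module IsDerivation)
  open BiquadraticField F
  open BiquadraticOrder F
  -- Cancellation and non-vanishing in K serve for 𝒜 as they stand, since equality and operations of
  -- 𝒜 are those of K on first components.
  open Biquadratic.Roots.Classification 𝒜 m n √m √n √m² √n² span *-cancel-0 (≈0? degree ∘ proj₁)
    double-0 (root-≉0 m m-sf root-m²) (root-≉0 n n-sf root-n²)
  criterion = leibniz⇔exactlyOne (unital σ σ-endo) (unital τ τ-endo)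
    (LeftModuleMorphisms.IsLeftModuleHomomorphism.+ᴹ-isGroupHomomorphism D-linear) D1≈0 D≉0
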